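{- Let $n\ge1$ and let $g_1,\dots,g_n$ be the free generators of $\mathcal F_n$. The generic Kripke model $\mathfrak K_n=(K_n,\le,\mathrm{val})$ is, as a partial order, the principal ideal spectrum of $\mathcal F_n$ (equivalently, of $\widehat{\mathcal F_n}$) ordered by inclusion: the map sending $w\in K_n$ to the principal ideal generated by $K_n\setminus\{w\}^\uparrow$ is an isomorphism of partial orders from $(K_n,\le)$ onto $(\mathrm{Spec}^0_\downarrow(\mathcal F_n),\subseteq)$, and likewise onto $(\mathrm{Spec}^0_\downarrow(\widehat{\mathcal F_n}),\subseteq)$. Under this identification, the valuations are determined by the images $\bar I_0(g_j)$ of the free generators: for a principal prime ideal $\mathfrak i$ and $1\le j\le n$, one has $P_j\in\mathrm{val}(\mathfrak i)$ iff $g_j\notin\mathfrak i$, or equivalently, iff $\mathfrak i\in\bar I_0(g_j)$.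
   Context: Fix $n\ge1$ and symbols $P_1,\dots,P_n$. The generic Kripke model $\mathfrak K_n=(K_n,\le,\mathrm{val})$ consists of a partially ordered set $(K_n,\le)$ and a valuation map $\mathrm{val}:K_n\to\mathfrak P(\{P_1,\dots,P_n\})$; it is the increasing union of finite pieces $K_n^d$ ($d\ge 0$) built recursively: $K_n^{ -1}=\emptyset$, and $K_n^d\setminus K_n^{d-1}$ consists of exactly one point $w_{\beta,Y}$ for each pair $(\beta,Y)$ such that (i) $Y$ is a decreasing subset of $K_n^{d-1}$ with $Y\not\subseteq K_n^{d-2}$ (for $d=0$ this last condition is void, so $Y=\emptyset$); (ii) $\beta\subseteq\{P_1,\dots,P_n\}$ and $\beta\subseteq\mathrm{val}(w')$ for all $w'\in Y$; (iii) if $Y$ is the decreasing set generated by a single element $w_{\beta',Y'}$, then $\beta\ne\beta'$. One sets $\mathrm{val}(w_{\beta,Y})=\beta$, and $w\le w_{\beta,Y}$ iff $w\in Y$ or $w=w_{\beta,Y}$. $\widehat{\mathcal F_n}:=\mathcal O_\downarrow(K_n,\le)$ is the Heyting algebra of all decreasing subsets of $K_n$ ($\sqcap=\cap$, $\sqcup=\cup$, $a\to b$ = the largest decreasing set contained in $(K_n\setminus a)\cup b$). By a theorem of Bellissima, the Heyting sub-algebra of $\widehat{\mathcal F_n}$ generated by $g_i=\{w\in K_n: P_i\in\mathrm{val}(w)\}$, $i=1,\dots,n$, is free on $g_1,\dots,g_n$; the free Heyting algebra $\mathcal F_n$ is identified with it. It contains all sets $K_n\setminus\{w\}^\uparrow$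 ($w\in K_n$), where $\{w\}^\uparrow=\{v\in K_n: v\ge w\}$. For a Heyting algebra $H$, a principal ideal is a set $(x)_\downarrow=\{y\in H: y\le x\}$ with $x\ne1$, $\mathrm{Spec}^0_\downarrow(H)$ is the set of all principal prime ideals, and $\bar I_0(a)=\{\mathfrak i\in\mathrm{Spec}^0_\downarrow(H)\mid a\notin\mathfrak i\}$ for $a\in H$. -}

module Defs where

open import Data.Bool.Base using (Bool; T)
open import Data.Empty using (⊥)
open import Data.Fin.Base using (Fin)
open import Data.Fin.Subset using (Subset; _∈_; _⊆_)
open import Data.Nat.Base using (ℕ; zero; suc; _<′_; ≤′-reflexive; ≤′-refl; ≤′-step)
open import Data.Nat.Properties using (≤′⇒≤; ≤′-trans; <-asym; <-irrefl)
open import Data.Product using (Σ; ∃; _×_; _,_; proj₁; proj₂)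
import Data.Product as Product
open import Data.Sum using (_⊎_; inj₁; inj₂; [_,_])
import Data.Sum as Sum
open import Data.Unit using (⊤; tt)
open import Function.Base using (id; _∘_)
open import Function.Bundles using (_⇔_)
open import Level using (Level; 0ℓ; _⊔_) renaming (suc to lsuc)
open import Relation.Binary.Bundles using (Poset)
open import Relation.Binary.Core using (Rel)
open import Relation.Binary.Definitions using (Transitive; Antisymmetric)
import Relation.Binary.Construct.On as On
open import Relation.Binary.Lattice.Bundles using (HeytingAlgebra)
open import Relation.Binary.Morphism.Structures using (IsOrderIsomorphism)
open import Relation.Binary.PropositionalEquality
  using (_≡_; _≢_; _≗_; refl; sym; trans; subst)
open import Relation.Nullary using (¬_; contradiction)
import Relation.Unary as U
open import Relation.Unary using (Pred; _≐_)
open import Relation.Unary.Relation.Binary.Subset using (⊆-poset)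

module _ {c ℓ₁ ℓ₂ : Level} (H : HeytingAlgebra c ℓ₁ ℓ₂) where

  private module H = HeytingAlgebra H

  principalIdeal : H.Carrier → Pred H.Carrier ℓ₂
  principalIdeal x y = y H.≤ x

  record IsPrimeIdeal {ℓ} (I : Pred H.Carrier ℓ) : Set (c ⊔ ℓ₂ ⊔ ℓ) where
    field
      ⊥∈I         : I H.⊥
      ∨-closed    : ∀ {x y} → I x → I y → I (x H.∨ y)
      downClosed  : ∀ {x y} → x H.≤ y → I y → I x
      ⊤∉I         : ¬ I H.⊤
      prime       : ∀ {x y} → I (x H.∧ y) → I x ⊎ I y

  record IsPrincipalPrimeIdeal (I : Pred H.Carrier ℓ₂) : Set (c ⊔ ℓ₁ ⊔ ℓ₂) where
    field
      isPrimeIdeal : IsPrimeIdeal I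
      principal    : ∃ λ x → ¬ (x H.≈ H.⊤) × (I ≐ principalIdeal x)

  record PrincipalPrimeIdeal : Set (c ⊔ ℓ₁ ⊔ lsuc ℓ₂) where
    constructor mkPrincipalPrimeIdeal
    field
      ideal                 : Pred H.Carrier ℓ₂
      isPrincipalPrimeIdeal : IsPrincipalPrimeIdeal ideal

  open PrincipalPrimeIdeal public

  -- Ordered by inclusion; equality is equality of ideals as sets.
  Spec⁰ : Poset (c ⊔ ℓ₁ ⊔ lsuc ℓ₂) (c ⊔ ℓ₂) (c ⊔ ℓ₂)
  Spec⁰ = On.poset (⊆-poset H.Carrier ℓ₂) ideal

  Ī₀ : H.Carrier → Pred PrincipalPrimeIdeal ℓ₂
  Ī₀ a 𝔦 = ¬ ideal 𝔦 a

module _ {c ℓ₁ ℓ₂ i : Level} (H : HeytingAlgebra c ℓ₁ ℓ₂) {I : Set i}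
         (g : I → HeytingAlgebra.Carrier H) where

  private module H = HeytingAlgebra H

  data Generated : H.Carrier → Set (c ⊔ ℓ₁ ⊔ i) where
    gen  : ∀ j → Generated (g j)
    top  : Generated H.⊤
    bot  : Generated H.⊥
    join : ∀ {x y} → Generated x → Generated y → Generated (x H.∨ y)
    meet : ∀ {x y} → Generated x → Generated y → Generated (x H.∧ y)
    impl : ∀ {x y} → Generated x → Generated y → Generated (x H.⇨ y)
    resp : ∀ {x y} → x H.≈ y → Generated x → Generated y

  generatedSubalgebra : HeytingAlgebra (c ⊔ ℓ₁ ⊔ i) ℓ₁ ℓ₂
  generatedSubalgebra = record
    { Carrier = Σ H.Carrier Generated
    ; _≈_     = λ x y → proj₁ x H.≈ proj₁ y
    ; _≤_     = λ x y → proj₁ x H.≤ proj₁ y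
    ; _∨_     = λ (x , p) (y , q) → x H.∨ y , join p q
    ; _∧_     = λ (x , p) (y , q) → x H.∧ y , meet p q
    ; _⇨_     = λ (x , p) (y , q) → x H.⇨ y , impl p q
    ; ⊤       = H.⊤ , top
    ; ⊥       = H.⊥ , bot
    ; isHeytingAlgebra = record
      { isBoundedLattice = record
        { isLattice = record
          { isPartialOrder = On.isPartialOrder proj₁ H.isPartialOrder
          ; supremum = λ (x , _) (y , _) →
              H.x≤x∨y x y , H.y≤x∨y x y , λ _ → H.∨-least
          ; infimum  = λ (x , _) (y , _) →
              H.x∧y≤x x y , H.x∧y≤y x y , λ _ → H.∧-greatest
          }
        ; maximum = λ (x , _) → H.maximum x
        ; minimum = λ (x , _) → H.minimum x
        }
      ; exponential = λ (w , _) (x , _) (y , _) → H.exponential w x y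
      }
    }

module _ (P : Poset 0ℓ 0ℓ 0ℓ) where

  private module P = Poset P

  record DecreasingSet : Set₁ where
    constructor mkDecreasingSet
    field
      mem        : Pred P.Carrier 0ℓ
      decreasing : ∀ {u v} → u P.≤ v → mem v → mem u

  open DecreasingSet public

  𝒪↓ : HeytingAlgebra (lsuc 0ℓ) 0ℓ 0ℓ
  𝒪↓ = record
    { Carrier = DecreasingSet
    ; _≈_     = λ a b → mem a ≐ mem b
    ; _≤_     = λ a b → mem a U.⊆ mem b
    ; _∨_     = λ a b → mkDecreasingSet (mem a U.∪ mem b)
                  (λ u≤v → Sum.map (decreasing a u≤v) (decreasing b u≤v))
    ; _∧_     = λ a b → mkDecreasingSet (mem a U.∩ mem b)
                  (λ u≤v → Product.map (decreasing a u≤v) (decreasing b u≤v))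
      -- Classically, the largest decreasing set contained in (P ∖ a) ∪ b.
    ; _⇨_     = λ a b → mkDecreasingSet
                  (λ w → ∀ v → v P.≤ w → mem a v → mem b v)
                  (λ u≤w f v v≤u → f v (P.trans v≤u u≤w))
    ; ⊤       = mkDecreasingSet (λ _ → ⊤) (λ _ _ → tt)
    ; ⊥       = mkDecreasingSet (λ _ → ⊥) (λ _ ())
    ; isHeytingAlgebra = record
      { isBoundedLattice = record
        { isLattice = record
          { isPartialOrder = On.isPartialOrder mem
              (Poset.isPartialOrder (⊆-poset P.Carrier 0ℓ))
          ; supremum = λ _ _ → inj₁ , inj₂ , λ _ f g → [ f , g ]
          ; infimum  = λ _ _ → proj₁ , proj₂ , λ _ f g x → f x , g x
          }
        ; maximum = λ _ _ → tt
        ; minimum = λ _ ()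
        }
      ; exponential = λ w x y →
          (λ f w∋u v v≤u x∋v → f (decreasing w v≤u w∋u , x∋v)) ,
          (λ f (w∋u , x∋u) → f w∋u _ P.refl x∋u)
      }
    }

  -- The complement of {w}↑.
  ∁↑ : P.Carrier → DecreasingSet
  ∁↑ w = mkDecreasingSet (λ v → ¬ (w P.≤ v))
                         (λ u≤v w≰v w≤u → w≰v (P.trans w≤u u≤v))

module _ (n : ℕ) where

  record Stage : Set₁ where
    infix 4 _≤_
    field
      Pt      : Set
      _≤_     : Rel Pt 0ℓ
      val     : Pt → Subset n
      -- For the stage K^d with d ≥ 0, Exceeds Y says Y ⊈ K^(d-1); for the
      -- empty stage K^(-1) it is void.
      Exceeds : Pred (Pt → Bool) 0ℓ

  -- The points w_{β,Y} of K^d ∖ K^(d-1), where S is K^(d-1).  Stages are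
  -- finite, so Boolean characteristic functions represent all their subsets.
  record NewPoint (S : Stage) : Set where
    open Stage S
    field
      β       : Subset n
      Y       : Pt → Bool
      Y-decr  : ∀ {u v} → u ≤ v → T (Y v) → T (Y u)
      exceeds : Exceeds Y
      β⊆val   : ∀ {u} → T (Y u) → β ⊆ val u
      β≢val   : ∀ {v} → (∀ u → T (Y u) ⇔ u ≤ v) → β ≢ val v

  open NewPoint

  -- A point is determined by the pair (β , Y), with Y compared as a set.
  record _≋_ {S : Stage} (p q : NewPoint S) : Set where
    constructor mk≋
    field
      β≡ : β p ≡ β q
      Y≗ : Y p ≗ Y q

  emptyStage : Stage
  emptyStage = record
    { Pt = ⊥ ; _≤_ = λ () ; val = λ () ; Exceeds = λ _ → ⊤ }

  extend : Stage → Stage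
  extend S = record
    { Pt      = Pt ⊎ NewPoint S
    ; _≤_     = le
    ; val     = [ val , β ]
    ; Exceeds = λ Z → ∃ λ p → T (Z (inj₂ p))
    }
    where
    open Stage S
    le : Rel (Pt ⊎ NewPoint S) 0ℓ
    le (inj₁ u) (inj₁ v) = u ≤ v
    le (inj₁ u) (inj₂ q) = T (Y q u)
    le (inj₂ p) (inj₁ v) = ⊥
    le (inj₂ p) (inj₂ q) = p ≋ q

  -- stage d is K^(d-1), and Layer d is K^d ∖ K^(d-1).
  stage : ℕ → Stage
  stage zero    = emptyStage
  stage (suc d) = extend (stage d)

  Layer : ℕ → Set
  Layer d = NewPoint (stage d)

  embed : ∀ {d e} → d <′ e → Layer d → Stage.Pt (stage e)
  embed ≤′-refl       p = inj₂ p
  embed (≤′-step d<e) p = inj₁ (embed d<e p)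

  -- The union of the K^d, as the disjoint union of the layers.
  Point : Set
  Point = Σ ℕ Layer

  val : Point → Subset n
  val (_ , p) = β p

  data _≈ᴷ_ : Rel Point 0ℓ where
    layer : ∀ {d} {p q : Layer d} → p ≋ q → (d , p) ≈ᴷ (d , q)

  data _≤ᴷ_ : Rel Point 0ℓ where
    equal : ∀ {w w′} → w ≈ᴷ w′ → w ≤ᴷ w′
    below : ∀ {d e} {p : Layer d} {q : Layer e} (d<e : d <′ e) →
            T (Y q (embed d<e p)) → (d , p) ≤ᴷ (e , q)

  embed-irr : ∀ {d e} (r s : d <′ e) (p : Layer d) → embed r p ≡ embed s p
  embed-irr ≤′-refl ≤′-refl p = refl
  embed-irr ≤′-refl (≤′-step s) p = contradiction (≤′⇒≤ s) (<-irrefl refl)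
  embed-irr (≤′-step r) ≤′-refl p = contradiction (≤′⇒≤ r) (<-irrefl refl)
  embed-irr (≤′-step r) (≤′-step s) p rewrite embed-irr r s p = refl

  embed-val : ∀ {d e} (r : d <′ e) (p : Layer d) →
              Stage.val (stage e) (embed r p) ≡ β p
  embed-val ≤′-refl     p = refl
  embed-val (≤′-step r) p = embed-val r p

  embed-≋ : ∀ {d e} (r : d <′ e) {p q : Layer d} → p ≋ q →
            Stage._≤_ (stage e) (embed r p) (embed r q)
  embed-≋ ≤′-refl     p≋q = p≋q
  embed-≋ (≤′-step r) p≋q = embed-≋ r p≋q

  <′-trans : ∀ {d e f} → d <′ e → e <′ f → d <′ f
  <′-trans r s = ≤′-trans (≤′-step r) s

  embed-< : ∀ {d e f} (r : d <′ e) (s : e <′ f) (t : d <′ f)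
            {p : Layer d} {q : Layer e} → T (Y q (embed r p)) →
            Stage._≤_ (stage f) (embed t p) (embed s q)
  embed-< r ≤′-refl t {p} {q} h rewrite embed-irr t (≤′-step r) p = h
  embed-< r (≤′-step s) t {p} {q} h
    rewrite embed-irr t (≤′-step (<′-trans r s)) p =
    embed-< r s (<′-trans r s) {p} {q} h

  ≈ᴷ-refl : ∀ {w} → w ≈ᴷ w
  ≈ᴷ-refl = layer (mk≋ refl (λ _ → refl))

  ≈ᴷ-sym : ∀ {w w′} → w ≈ᴷ w′ → w′ ≈ᴷ w
  ≈ᴷ-sym (layer (mk≋ b y)) = layer (mk≋ (sym b) (λ u → sym (y u)))

  ≈ᴷ-trans : Transitive _≈ᴷ_
  ≈ᴷ-trans (layer (mk≋ b y)) (layer (mk≋ b′ y′)) =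
    layer (mk≋ (trans b b′) (λ u → trans (y u) (y′ u)))

  ≤ᴷ-trans : Transitive _≤ᴷ_
  ≤ᴷ-trans (equal e) (equal e′) = equal (≈ᴷ-trans e e′)
  ≤ᴷ-trans (equal (layer p≋q)) (below {q = q} r h) =
    below r (Y-decr q (embed-≋ r p≋q) h)
  ≤ᴷ-trans (below r h) (equal (layer (mk≋ _ y))) = below r (subst T (y _) h)
  ≤ᴷ-trans (below {p = p} {q = q} r h) (below {q = q′} s h′) =
    below t (Y-decr q′ (embed-< r s t {p} {q} h) h′)
    where t = <′-trans r s

  ≤ᴷ-antisym : Antisymmetric _≈ᴷ_ _≤ᴷ_
  ≤ᴷ-antisym (equal e) _ = e
  ≤ᴷ-antisym (below _ _) (equal e) = ≈ᴷ-sym e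
  ≤ᴷ-antisym (below r _) (below s _) =
    contradiction (≤′⇒≤ s) (<-asym (≤′⇒≤ r))

  val-antitone : ∀ {v w} → v ≤ᴷ w → val w ⊆ val v
  val-antitone (equal (layer (mk≋ b _))) j∈ = subst (_ ∈_) (sym b) j∈
  val-antitone (below {p = p} {q = q} r h) j∈ =
    subst (_ ∈_) (embed-val r p) (β⊆val q h j∈)

  K : Poset 0ℓ 0ℓ 0ℓ
  K = record
    { Carrier = Point
    ; _≈_     = _≈ᴷ_
    ; _≤_     = _≤ᴷ_
    ; isPartialOrder = record
      { isPreorder = record
        { isEquivalence = record
            { refl = ≈ᴷ-refl ; sym = ≈ᴷ-sym ; trans = ≈ᴷ-trans }
        ; reflexive = equal
        ; trans     = ≤ᴷ-trans
        }
      ; antisym = ≤ᴷ-antisym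
      }
    }

  ℱ̂ : HeytingAlgebra (lsuc 0ℓ) 0ℓ 0ℓ
  ℱ̂ = 𝒪↓ K

  ĝ : Fin n → HeytingAlgebra.Carrier ℱ̂
  ĝ j = mkDecreasingSet (λ w → j ∈ val w) (λ v≤w → val-antitone v≤w)

  -- The free Heyting algebra on n generators: by Bellissima's theorem, the
  -- subalgebra generated by the ĝ j is free on them.
  ℱ : HeytingAlgebra (lsuc 0ℓ) 0ℓ 0ℓ
  ℱ = generatedSubalgebra ℱ̂ ĝ

  g : Fin n → HeytingAlgebra.Carrier ℱ
  g j = ĝ j , gen j

  record IdentifiesSpectrum {c ℓ₁ ℓ₂} (H : HeytingAlgebra c ℓ₁ ℓ₂)
      (x : Point → HeytingAlgebra.Carrier H)
      (h : Fin n → HeytingAlgebra.Carrier H) : Set (lsuc (c ⊔ ℓ₁ ⊔ ℓ₂)) where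
    private module Spec = Poset (Spec⁰ H)
    field
      inSpec : ∀ w → IsPrincipalPrimeIdeal H (principalIdeal H (x w))

    φ : Point → Spec.Carrier
    φ w = mkPrincipalPrimeIdeal (principalIdeal H (x w)) (inSpec w)

    -- The valuation carried over to 𝔦 along φ is val w for any w with φ w ≈ 𝔦.
    field
      isOrderIsomorphism : IsOrderIsomorphism _≈ᴷ_ Spec._≈_ _≤ᴷ_ Spec._≤_ φ
      val⇔∉  : ∀ {w 𝔦} → φ w Spec.≈ 𝔦 → ∀ j → j ∈ val w ⇔ (¬ ideal 𝔦 (h j))
      val⇔Ī₀ : ∀ {w 𝔦} → φ w Spec.≈ 𝔦 → ∀ j → j ∈ val w ⇔ Ī₀ H (h j) 𝔦

-- A point w of Kₙ is determined by val w together with the points strictly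
-- below it, and only finitely many points lie below w.  Well-founded induction
-- on w therefore expresses both {w}↓ and Kₙ ∖ {w}↑ by the generators:
-- Kₙ ∖ {w}↑ = {w}↓ → ({w}↓ ∖ {w}), while v ≤ w iff val w ⊆ val v and every
-- u ≤ v with val u ⊈ val w, or not above all points strictly below w, is
-- itself strictly below w.
-- Given these elements, w is prime because a decreasing set lies in Kₙ ∖ {w}↑
-- iff it omits w.  Conversely, if a ≠ 1 generates a prime ideal and w is
-- minimal outside a, then {w}↓ ∩ (Kₙ ∖ {w}↑) ⊆ a forces a = Kₙ ∖ {w}↑.

module Submission where

open import Defs
open import Axiom.ExcludedMiddle using (ExcludedMiddle)
open import Axiom.DoubleNegationElimination using (em⇒dne)
open import Data.Bool.Base using (Bool; true; false; T)
open import Data.Fin.Base using (Fin)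
open import Data.Fin.Subset using (Subset; _∈_; _⊆_; _∉_)
open import Data.Fin.Subset.Properties using (_∈?_; ⊆-antisym)
open import Data.List.Base using (List; []; _∷_; _++_; map; filter; allFin)
import Data.List.Membership.Propositional as List
open import Data.List.Membership.Propositional using (find; lose)
open import Data.List.Membership.Propositional.Properties
  using (∈-map⁺; ∈-++⁺ˡ; ∈-++⁺ʳ; ∈-filter⁺; ∈-filter⁻; ∈-allFin)
open import Data.List.Relation.Unary.All as All using (All; []; _∷_)
import Data.List.Relation.Unary.All.Properties as All
open import Data.List.Relation.Unary.Any as Any using (Any; here; there)
open import Data.Nat.Base using (ℕ; zero; suc; _≤_; z≤n; _<′_; ≤′-refl; ≤′-step)
open import Data.Nat.Induction using (<′-wellFounded)
open import Data.Nat.Properties using (≤′⇒≤; ≤-antisym)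
import Data.Nat.Properties as ℕ
open import Data.Product using (Σ-syntax; ∃; _×_; _,_; proj₁; proj₂)
open import Data.Sum using (_⊎_; inj₁; inj₂; [_,_])
open import Data.Unit using (tt)
open import Data.Vec.Base using (lookup)
open import Data.Vec.Properties using (tabulate∘lookup; tabulate-cong)
open import Function.Base using (_∘_; id)
open import Function.Bundles using (_⇔_; mk⇔; Equivalence)
open import Induction.WellFounded using (WellFounded; module All; module Subrelation)
open import Level using (0ℓ; _⊔_) renaming (suc to lsuc)
open import Relation.Binary.Bundles using (Poset)
import Relation.Binary.Construct.On as On
open import Relation.Binary.Lattice.Bundles using (HeytingAlgebra)
open import Relation.Binary.Morphism.Structures using (IsOrderIsomorphism)
import Relation.Binary.Properties.Poset as PosetProperties
open import Relation.Binary.PropositionalEquality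
  using (_≡_; refl; sym; trans; cong; subst; module ≡-Reasoning)
open import Relation.Nullary using (¬_; yes; no; contradiction)
open import Relation.Unary using (_≐_)

T-extensional : ∀ {b c} → (T b → T c) → (T c → T b) → b ≡ c
T-extensional {false} {false} _ _ = refl
T-extensional {false} {true}  _ g = contradiction (g tt) id
T-extensional {true}  {false} f _ = contradiction (f tt) id
T-extensional {true}  {true}  _ _ = refl

-- Principal primes in algebras of decreasing sets over a well-founded order.

module _ (P : Poset 0ℓ 0ℓ 0ℓ) where

  private
    module P = Poset P
  open PosetProperties P using (_<_; <⇒≱)

  ↓ : P.Carrier → DecreasingSet P
  ↓ w = mkDecreasingSet (P._≤ w) P.trans

  ↓⁻ : P.Carrier → DecreasingSet P
  ↓⁻ w = mkDecreasingSet (_< w) λ u≤v v<w →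
    P.trans u≤v (proj₁ v<w) ,
    λ u≈w → <⇒≱ v<w (P.trans (P.reflexive (P.Eq.sym u≈w)) u≤v)

  ⋃ ⋂ : {A : Set} → (A → DecreasingSet P) → List A → DecreasingSet P
  ⋃ f xs = mkDecreasingSet (λ w → Any (λ a → mem (f a) w) xs)
    (λ u≤v → Any.map (λ {a} → decreasing (f a) u≤v))
  ⋂ f xs = mkDecreasingSet (λ w → All (λ a → mem (f a) w) xs)
    (λ u≤v → All.map (λ {a} → decreasing (f a) u≤v))

  module _ {I : Set} (g : I → DecreasingSet P) where

    ⋃-generated : {A : Set} {f : A → DecreasingSet P} {xs : List A} →
                  All (Generated (𝒪↓ P) g ∘ f) xs → Generated (𝒪↓ P) g (⋃ f xs)
    ⋃-generated []       = resp ((λ ()) , λ ()) bot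
    ⋃-generated (p ∷ ps) =
      resp ([ here , there ] , Any.toSum) (join p (⋃-generated ps))

    ⋂-generated : {A : Set} {f : A → DecreasingSet P} {xs : List A} →
                  All (Generated (𝒪↓ P) g ∘ f) xs → Generated (𝒪↓ P) g (⋂ f xs)
    ⋂-generated []       = resp ((λ _ → []) , λ _ → tt) top
    ⋂-generated (p ∷ ps) =
      resp ((λ (q , qs) → q ∷ qs) , All.uncons) (meet p (⋂-generated ps))

  -- What `ℱ` and `ℱ̂` share: an order embedding into decreasing sets that reaches every `↓ w` and
  -- `∁↑ w`. Only the order is mentioned; `↓≤⇔∈` recovers how `⊤` and `∧` act on points.
  record Representation {c ℓ₁ ℓ₂} (H : HeytingAlgebra c ℓ₁ ℓ₂) : Set (lsuc 0ℓ ⊔ c ⊔ ℓ₂) where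
    private module H = HeytingAlgebra H
    field
      ⟦_⟧    : H.Carrier → DecreasingSet P
      mono   : ∀ {a b} → a H.≤ b → ∀ {v} → mem ⟦ a ⟧ v → mem ⟦ b ⟧ v
      cancel : ∀ {a b} → (∀ {v} → mem ⟦ a ⟧ v → mem ⟦ b ⟧ v) → a H.≤ b
      ↓ᴴ x   : P.Carrier → H.Carrier
      ↓ᴴ≐    : ∀ w → mem ⟦ ↓ᴴ w ⟧ ≐ mem (↓ w)
      x≐     : ∀ w → mem ⟦ x w ⟧ ≐ mem (∁↑ P w)

  module _ (em : ExcludedMiddle 0ℓ) (wf : WellFounded _<_) where

    minimal-∉ : (a : DecreasingSet P) → ∀ w → ¬ mem a w →
                ∃ λ v → ¬ mem a v × (∀ {u} → u < v → mem a u)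
    minimal-∉ a = All.wfRec wf 0ℓ _ step
      where
      step : ∀ w → (∀ {u} → u < w → ¬ mem a u → _) → ¬ mem a w →
             ∃ λ v → ¬ mem a v × (∀ {u} → u < v → mem a u)
      step w rec w∉a with em {∃ λ u → u < w × ¬ mem a u}
      ... | yes (u , u<w , u∉a) = rec u<w u∉a
      ... | no  none            =
        w , w∉a , λ u<w → em⇒dne em λ u∉a → none (_ , u<w , u∉a)

    module PrincipalPrimes {c ℓ₁ ℓ₂} (H : HeytingAlgebra c ℓ₁ ℓ₂)
                           (R : Representation H) where

      open Representation R

      private
        module H = HeytingAlgebra H
        module Spec = Poset (Spec⁰ H)

      ↓≤⇔∈ : ∀ {w a} → ↓ᴴ w H.≤ a ⇔ mem ⟦ a ⟧ w
      ↓≤⇔∈ {w} {a} = mk⇔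
        (λ ↓w≤a → mono ↓w≤a (proj₂ (↓ᴴ≐ w) P.refl))
        (λ w∈a → cancel λ v∈↓w → decreasing ⟦ a ⟧ (proj₁ (↓ᴴ≐ w) v∈↓w) w∈a)

      ≤x⇔∉ : ∀ {w a} → a H.≤ x w ⇔ (¬ mem ⟦ a ⟧ w)
      ≤x⇔∉ {w} {a} = mk⇔
        (λ a≤x w∈a → proj₁ (x≐ w) (mono a≤x w∈a) P.refl)
        (λ w∉a → cancel λ v∈a → proj₂ (x≐ w) λ w≤v →
          w∉a (decreasing ⟦ a ⟧ w≤v v∈a))

      open module ↓≤⇔∈ {w} {a} = Equivalence (↓≤⇔∈ {w} {a})
        using () renaming (to to ↓≤⇒∈; from to ∈⇒↓≤)
      open module ≤x⇔∉ {w} {a} = Equivalence (≤x⇔∉ {w} {a})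
        using () renaming (to to ≤x⇒∉; from to ∉⇒≤x)

      ∈-⊤ : ∀ w → mem ⟦ H.⊤ ⟧ w
      ∈-⊤ w = ↓≤⇒∈ (H.maximum _)

      ∈-∧ : ∀ {a b w} → mem ⟦ a ⟧ w → mem ⟦ b ⟧ w → mem ⟦ a H.∧ b ⟧ w
      ∈-∧ w∈a w∈b = ↓≤⇒∈ (H.∧-greatest (∈⇒↓≤ w∈a) (∈⇒↓≤ w∈b))

      inSpec : ∀ w → IsPrincipalPrimeIdeal H (principalIdeal H (x w))
      inSpec w = record
        { isPrimeIdeal = record
          { ⊥∈I        = H.minimum _
          ; ∨-closed   = H.∨-least
          ; downClosed = H.trans
          ; ⊤∉I        = ⊤≰x
          ; prime      = prime
          }
        ; principal = x w , ⊤≰x ∘ H.reflexive ∘ H.Eq.sym , id , id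
        }
        where
        ⊤≰x : ¬ (H.⊤ H.≤ x w)
        ⊤≰x ⊤≤x = ≤x⇒∉ ⊤≤x (∈-⊤ w)

        prime : ∀ {a b} → a H.∧ b H.≤ x w → a H.≤ x w ⊎ b H.≤ x w
        prime {a} {b} a∧b≤x with em {mem ⟦ a ⟧ w}
        ... | yes w∈a = inj₂ (∉⇒≤x λ w∈b → ≤x⇒∉ a∧b≤x (∈-∧ w∈a w∈b))
        ... | no  w∉a = inj₁ (∉⇒≤x w∉a)

      φ : P.Carrier → Spec.Carrier
      φ w = mkPrincipalPrimeIdeal (principalIdeal H (x w)) (inSpec w)

      φ-mono : ∀ {w v} → w P.≤ v → φ w Spec.≤ φ v
      φ-mono w≤v {a} a≤xw = ∉⇒≤x λ v∈a → ≤x⇒∉ a≤xw (decreasing ⟦ a ⟧ w≤v v∈a)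

      φ-cong : ∀ {w v} → w P.≈ v → φ w Spec.≈ φ v
      φ-cong w≈v = φ-mono (P.reflexive w≈v) , φ-mono (P.reflexive (P.Eq.sym w≈v))

      φ-cancel : ∀ {w v} → φ w Spec.≤ φ v → w P.≤ v
      -- The inclusion is tested on the generator `x w` of `φ w`: if `w ≰ v`, then `v` lies in
      -- `∁↑ w`, so `x w` is not in `φ v`.
      φ-cancel {w} {v} φw≤φv = em⇒dne em λ w≰v →
        ≤x⇒∉ (φw≤φv H.refl) (proj₂ (x≐ w) w≰v)

      φ-surjective : ∀ 𝔦 → ∃ λ w → φ w Spec.≈ 𝔦
      φ-surjective 𝔦 with IsPrincipalPrimeIdeal.principal (isPrincipalPrimeIdeal 𝔦)
      ... | a , a≉⊤ , 𝔦⊆a , a⊆𝔦 =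
        let (_ , v∉a)        = em⇒dne em {∃ λ v → ¬ mem ⟦ a ⟧ v} λ none → a≉⊤
                                 (H.antisym (H.maximum a)
                                   (cancel λ _ → em⇒dne em λ v∉a → none (_ , v∉a)))
            (w , w∉a , <w⊆a) = minimal-∉ ⟦ a ⟧ _ v∉a
        in w , φw⊆𝔦 w∉a <w⊆a , λ b∈𝔦 → H.trans (𝔦⊆a b∈𝔦) (∉⇒≤x w∉a)
        where
        open IsPrimeIdeal (IsPrincipalPrimeIdeal.isPrimeIdeal (isPrincipalPrimeIdeal 𝔦))

        φw⊆𝔦 : ∀ {w} → ¬ mem ⟦ a ⟧ w → (∀ {u} → u < w → mem ⟦ a ⟧ u) →
               φ w Spec.≤ 𝔦
        -- It suffices that `x w` is in `𝔦`. Points of `↓ᴴ w ∧ x w` lie strictly below `w`, hence in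
        -- `a`, so this meet is in `𝔦`; primeness leaves `x w`, since `↓ᴴ w` in `𝔦` would put `w` in
        -- `a`.
        φw⊆𝔦 {w} w∉a <w⊆a b≤x = downClosed b≤x
          ([ (λ ↓w∈𝔦 → contradiction (↓≤⇒∈ (𝔦⊆a ↓w∈𝔦)) w∉a) , id ]
            (prime (a⊆𝔦 (cancel λ v∈∧ → <w⊆a
              ( proj₁ (↓ᴴ≐ w) (mono (H.x∧y≤x _ _) v∈∧)
              , λ v≈w → proj₁ (x≐ w) (mono (H.x∧y≤y _ _) v∈∧)
                  (P.reflexive (P.Eq.sym v≈w)))))))

      φ-isOrderIsomorphism : IsOrderIsomorphism P._≈_ Spec._≈_ P._≤_ Spec._≤_ φ
      φ-isOrderIsomorphism = record
        { isOrderMonomorphism = record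
          { isOrderHomomorphism = record { cong = φ-cong ; mono = φ-mono }
          ; injective = λ (φw≤φv , φv≤φw) → P.antisym (φ-cancel φw≤φv) (φ-cancel φv≤φw)
          ; cancel    = φ-cancel
          }
        ; surjective = λ 𝔦 → let (w , φw≈𝔦) = φ-surjective 𝔦 in
            w , λ {z} z≈w → Spec.Eq.trans {φ z} {φ w} {𝔦} (φ-cong z≈w) φw≈𝔦
        }

      ∈⇔∉ideal : ∀ {w 𝔦} → φ w Spec.≈ 𝔦 → ∀ a → mem ⟦ a ⟧ w ⇔ (¬ ideal 𝔦 a)
      ∈⇔∉ideal (φw⊆𝔦 , 𝔦⊆φw) a = mk⇔
        (λ w∈a a∈𝔦 → ≤x⇒∉ (𝔦⊆φw a∈𝔦) w∈a)
        (λ a∉𝔦 → em⇒dne em λ w∉a → a∉𝔦 (φw⊆𝔦 (∉⇒≤x w∉a)))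

-- Finiteness of the stages.

module _ (em : ExcludedMiddle 0ℓ) where

  -- Splits `A` by the value of the first test and recurses on both fibres; an empty fibre
  -- contributes nothing. The map `f` is carried along because on a fibre the remaining tests act
  -- through `proj₁`.
  representatives : {A B : Set} (f : A → B) (ts : List (B → Bool)) →
    ∃ λ (xs : List A) → ∀ a → ∃ λ a′ →
      a′ List.∈ xs × All (λ t → t (f a) ≡ t (f a′)) ts
  representatives {A} f [] with em {A}
  ... | yes a = a ∷ [] , λ _ → a , here refl , []
  ... | no ¬a = [] , λ a → contradiction a ¬a
  representatives f (t ∷ ts) = xs true ++ xs false , λ a → represent (t (f a)) (a , refl)
    where
    fibre : ∀ b → _
    fibre b = representatives (f ∘ proj₁ {B = λ a → t (f a) ≡ b}) ts

    xs : ∀ b → List _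
    xs b = map proj₁ (proj₁ (fibre b))

    xs⊆ : ∀ b {a} → a List.∈ xs b → a List.∈ xs true ++ xs false
    xs⊆ true  = ∈-++⁺ˡ
    xs⊆ false = ∈-++⁺ʳ (xs true)

    represent : ∀ b (a : ∃ λ a → t (f a) ≡ b) → ∃ λ a′ →
      a′ List.∈ xs true ++ xs false × All (λ t → t (f (proj₁ a)) ≡ t (f a′)) (t ∷ ts)
    represent b a = let ((a′ , ta′≡b) , a′∈ , same) = proj₂ (fibre b) a in
      a′ , xs⊆ b (∈-map⁺ proj₁ a′∈) , trans (proj₂ a) (sym ta′≡b) ∷ same

  module _ (n : ℕ) where

    open NewPoint
    open PosetProperties (K n) using (_<_; <-irrefl; <-respˡ-≈)
    private
      module K = Poset (K n)
      module S (d : ℕ) = Stage (stage n d)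

    -- Finiteness up to mutual `≤`: points carry functions and proofs, so distinct terms can stand
    -- for the same point.
    Listing : Stage n → Set
    Listing S = ∃ λ us → ∀ u → ∃ λ v → v List.∈ us × u ≤ˢ v × v ≤ˢ u
      where open Stage S renaming (_≤_ to _≤ˢ_)

    -- A new point is fixed up to `_≋_` by the bits of `β` and the values of `Y` at the listed
    -- points, since a decreasing `Y` is constant on classes of mutual `≤`. These are finitely many
    -- Boolean tests.
    extend-listing : ∀ {S} → Listing S → Listing (extend n S)
    extend-listing {S} (us , rep) = map inj₁ us ++ map inj₂ ps , λ where
        (inj₁ u) → let (v , v∈ , u≤v , v≤u) = rep u in
          inj₁ v , ∈-++⁺ˡ (∈-map⁺ inj₁ v∈) , u≤v , v≤u
        (inj₂ p) → let (q , q∈ , same) = repᴾ p in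
          inj₂ q , ∈-++⁺ʳ _ (∈-map⁺ inj₂ q∈) , ≋-intro same , ≋-intro (All.map sym same)
      where
      tests : List (NewPoint n S → Bool)
      tests = map (λ j p → lookup (β p) j) (allFin n) ++ map (λ u p → Y p u) us

      ps : List (NewPoint n S)
      ps = proj₁ (representatives id tests)

      repᴾ = proj₂ (representatives id tests)

      ≋-intro : ∀ {p q} → All (λ t → t p ≡ t q) tests → _≋_ n p q
      ≋-intro {p} {q} same = mk≋ β≡ Y≗
        where
        open ≡-Reasoning
        β≡ : β p ≡ β q
        β≡ = trans (sym (tabulate∘lookup (β p))) (trans
          (tabulate-cong λ j → All.lookup same (∈-++⁺ˡ (∈-map⁺ _ (∈-allFin j))))
          (tabulate∘lookup (β q)))

        Y-resp : ∀ r {u v} → Stage._≤_ S u v → Stage._≤_ S v u → Y r u ≡ Y r v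
        Y-resp r u≤v v≤u = T-extensional (Y-decr r v≤u) (Y-decr r u≤v)

        Y≗ : ∀ u → Y p u ≡ Y q u
        Y≗ u = let (v , v∈ , u≤v , v≤u) = rep u in begin
          Y p u ≡⟨ Y-resp p u≤v v≤u ⟩
          Y p v ≡⟨ All.lookup same (∈-++⁺ʳ _ (∈-map⁺ (λ u p → Y p u) v∈)) ⟩
          Y q v ≡⟨ Y-resp q v≤u u≤v ⟩
          Y q u ∎

    stage-listing : ∀ d → Listing (stage n d)
    stage-listing zero    = [] , λ ()
    stage-listing (suc d) = extend-listing (stage-listing d)

    -- Passage between the stages and the union of the layers.

    unembed : ∀ d (u : S.Pt d) →
              ∃ λ e → ∃ λ (p : Layer n e) → Σ[ r ∈ e <′ d ] embed n r p ≡ u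
    unembed (suc d) (inj₁ u) = let (e , p , r , eq) = unembed d u in
      e , p , ≤′-step r , cong inj₁ eq
    unembed (suc d) (inj₂ p) = d , p , ≤′-refl , refl

    embed-mono : ∀ {d e f} {p : Layer n d} {q : Layer n e} (r : d <′ f) (s : e <′ f) →
                 (d , p) K.≤ (e , q) → S._≤_ f (embed n r p) (embed n s q)
    embed-mono {p = p} r s (equal (layer p≋q)) rewrite embed-irr n r s p =
      embed-≋ n s p≋q
    embed-mono {p = p} {q} r s (below t p∈q) = embed-< n t s r {p} {q} p∈q

    embed-cancel : ∀ {d e f} {p : Layer n d} {q : Layer n e} (r : d <′ f) (s : e <′ f) →
                   S._≤_ f (embed n r p) (embed n s q) → (d , p) K.≤ (e , q)
    embed-cancel ≤′-refl     ≤′-refl     p≋q = equal (layer p≋q)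
    embed-cancel (≤′-step r) ≤′-refl     p∈q = below r p∈q
    embed-cancel (≤′-step r) (≤′-step s) p≤q = embed-cancel r s p≤q

    <⇒<′ : ∀ {v w : Point n} → v < w → proj₁ v <′ proj₁ w
    <⇒<′ (equal v≈w , v≉w) = contradiction v≈w v≉w
    <⇒<′ (below r _ , _)   = r

    <-wellFounded : WellFounded _<_
    <-wellFounded = Subrelation.wellFounded <⇒<′ (On.wellFounded proj₁ <′-wellFounded)

    <⇒∈Y : ∀ {d e} {p : Layer n d} {q : Layer n e} (r : d <′ e) →
           (d , p) < (e , q) → T (Y q (embed n r p))
    <⇒∈Y r (equal v≈w , v≉w) = contradiction v≈w v≉w
    <⇒∈Y {p = p} r (below s p∈q , _) rewrite embed-irr n r s p = p∈q

    ∈Y⇒< : ∀ {d e} {p : Layer n d} {q : Layer n e} (r : d <′ e) →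
           T (Y q (embed n r p)) → (d , p) < (e , q)
    ∈Y⇒< r p∈q = below r p∈q , λ { (layer _) → ℕ.<-irrefl refl (≤′⇒≤ r) }

    -- Strictly lower points lie in strictly earlier layers, so all of them embed in `stage n d`;
    -- its listing is pulled back along `unembed` and filtered by excluded middle.
    finite-↓⁻ : ∀ w → ∃ λ us → All (_< w) us ×
                (∀ {v} → v < w → ∃ λ u → u List.∈ us × v K.≈ u)
    finite-↓⁻ w@(d , p) = filter (λ u → em {u < w}) (map point us) ,
      All.all-filter (λ u → em {u < w}) (map point us) ,
      λ {v} v<w →
        let r                     = <⇒<′ v<w
            (u , u∈ , v≤u , u≤v)  = rep (embed n r (proj₂ v))
            (e , q , s , q≡u)     = unembed d u
            v≈u                   = K.antisym
              (embed-cancel r s (subst (S._≤_ d (embed n r (proj₂ v))) (sym q≡u) v≤u))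
              (embed-cancel s r (subst (λ x → S._≤_ d x (embed n r (proj₂ v))) (sym q≡u) u≤v))
        in point u , ∈-filter⁺ _ (∈-map⁺ point u∈) (<-respˡ-≈ v≈u v<w) , v≈u
      where
      us  = proj₁ (stage-listing d)
      rep = proj₂ (stage-listing d)

      point : S.Pt d → Point n
      point u = let (e , q , _) = unembed d u in e , q

    -- Recovering a point from its valuation and strict down-set.

    rank-mono : ∀ {v w : Point n} → (∀ {u} → u < v → u < w) → proj₁ v ≤ proj₁ w
    rank-mono {zero  , _} _    = z≤n
    -- `exceeds` provides a point of layer `d` strictly below `v`. It is then strictly below `w`,
    -- which forces the layer of `w` past `d`.
    rank-mono {suc d , p} v⊆w = let (p′ , p′∈p) = exceeds p in
      ≤′⇒≤ (<⇒<′ (v⊆w (∈Y⇒< {p = p′} {q = p} ≤′-refl p′∈p)))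

    -- Both points lie in the same layer by `rank-mono`, and the `Y` of each is its strict down-set
    -- seen through `embed`.
    ≈-extensional : ∀ {v w : Point n} → val n v ≡ val n w →
                    (∀ {u} → u < v → u < w) → (∀ {u} → u < w → u < v) → v K.≈ w
    ≈-extensional {v} {w} val≡ v⊆w w⊆v
      with ≤-antisym (rank-mono {v} {w} v⊆w) (rank-mono {w} {v} w⊆v)
    ≈-extensional {d , p} {d , q} val≡ v⊆w w⊆v | refl = layer (mk≋ val≡ Y≗)
      where
      Y≗ : ∀ u → Y p u ≡ Y q u
      Y≗ u with unembed d u
      ... | _ , _ , r , refl = T-extensional
        (<⇒∈Y r ∘ v⊆w ∘ ∈Y⇒< r) (<⇒∈Y r ∘ w⊆v ∘ ∈Y⇒< r)

    -- The clause `β≢val` carried over to the union of the layers; it rules out `w < v` in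
    -- `↓-formula-complete`.
    val-≢ : ∀ {v w : Point n} → (∀ {u} → u < v → u K.≤ w) → (∀ {u} → u K.≤ w → u < v) →
            ¬ (val n v ≡ val n w)
    val-≢ {e , q} {d , p} v⊆↓w ↓w⊆v val≡ =
      β≢val q Y≐↓ (trans val≡ (sym (embed-val n r p)))
      where
      r : d <′ e
      r = <⇒<′ (↓w⊆v K.refl)

      Y≐↓ : ∀ u → T (Y q u) ⇔ S._≤_ e u (embed n r p)
      Y≐↓ u with unembed e u
      ... | _ , _ , s , refl = mk⇔
        (embed-mono s r ∘ v⊆↓w ∘ ∈Y⇒< s)
        (<⇒∈Y s ∘ ↓w⊆v ∘ embed-cancel s r)

    -- Definability of `↓ w` and `∁↑ w` from the generators.

    Gen : DecreasingSet (K n) → Set₁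
    Gen = Generated (ℱ̂ n) (ĝ n)

    ⟨_⊆val⟩ ⟨val⊈_⟩ : Subset n → DecreasingSet (K n)
    ⟨ b ⊆val⟩ = mkDecreasingSet (λ v → b ⊆ val n v)
      (λ u≤v b⊆ → val-antitone n u≤v ∘ b⊆)
    ⟨val⊈ b ⟩ = mkDecreasingSet (λ v → ¬ val n v ⊆ b)
      (λ u≤v v⊈ u⊆ → v⊈ (u⊆ ∘ val-antitone n u≤v))

    ⟨⊉↓⁻_⟩ : Point n → DecreasingSet (K n)
    ⟨⊉↓⁻ w ⟩ = mkDecreasingSet (λ v → ¬ (∀ {u} → u < w → u K.≤ v))
      (λ u≤v v⊉ u⊇ → v⊉ λ x<w → K.trans (u⊇ x<w) u≤v)

    ⊆val-generated : ∀ b → Gen ⟨ b ⊆val⟩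
    ⊆val-generated b = resp
      ( (λ b∈ j∈b → All.lookup b∈ (∈-filter⁺ (_∈? b) (∈-allFin _) j∈b))
      , λ b⊆ → All.map b⊆ (All.all-filter (_∈? b) (allFin n)))
      (⋂-generated (K n) (ĝ n) (All.universal gen (filter (_∈? b) (allFin n))))

    -- Classically the negation is a finite join of the `ĝ j` with `j ∉ b`.
    val⊈-generated : ∀ b → Gen ⟨val⊈ b ⟩
    val⊈-generated b = resp
      ( (λ any v⊆b → let (_ , j∈ , j∈v) = find any in
           proj₂ (∈-filter⁻ _ {xs = allFin n} j∈) (v⊆b j∈v))
      , λ v⊈b → em⇒dne em λ none → v⊈b λ j∈v → em⇒dne em λ j∉b →
          none (lose (∈-filter⁺ _ (∈-allFin _) j∉b) j∈v))
      (⋃-generated (K n) (ĝ n)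
        (All.universal gen (filter (λ j → em {j ∉ b}) (allFin n))))

    module _ {w} (IH : ∀ {u} → u < w → Gen (↓ (K n) u) × Gen (∁↑ (K n) u)) where

      private
        us  = proj₁ (finite-↓⁻ w)
        us< = proj₁ (proj₂ (finite-↓⁻ w))
        rep = proj₂ (proj₂ (finite-↓⁻ w))

      ↓⁻-generated : Gen (↓⁻ (K n) w)
      ↓⁻-generated = resp
        ( (λ any → let (_ , u∈ , v≤u) = find any in
             decreasing (↓⁻ (K n) w) v≤u (All.lookup us< u∈))
        , λ v<w → let (_ , u∈ , v≈u) = rep v<w in lose u∈ (K.reflexive v≈u))
        (⋃-generated (K n) (ĝ n) (All.map (proj₁ ∘ IH) us<))

      -- Failing to be above some `u < w` means lying in `∁↑ u`, so this is a finite join of sets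
      -- supplied by `IH`.
      ⊉↓⁻-generated : Gen ⟨⊉↓⁻ w ⟩
      ⊉↓⁻-generated = resp
        ( (λ any v⊇ → let (_ , u∈ , u≰v) = find any in u≰v (v⊇ (All.lookup us< u∈)))
        , λ v⊉ → em⇒dne em λ none → v⊉ λ u<w → em⇒dne em λ u≰v →
            let (_ , x∈ , u≈x) = rep u<w in
            none (lose x∈ (u≰v ∘ K.trans (K.reflexive u≈x))))
        (⋃-generated (K n) (ĝ n) (All.map (proj₂ ∘ IH) us<))

    private
      module ℱ̂ = HeytingAlgebra (ℱ̂ n)

    -- The de Jongh formula of `w`, with all points strictly below `w` in place of its immediate
    -- predecessors.
    ↓-formula : Point n → DecreasingSet (K n)
    ↓-formula w = ⟨ val n w ⊆val⟩ ℱ̂.∧ ((⟨val⊈ val n w ⟩ ℱ̂.∨ ⟨⊉↓⁻ w ⟩) ℱ̂.⇨ ↓⁻ (K n) w)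

    ↓-formula-sound : ∀ {v w} → v K.≤ w → mem (↓-formula w) v
    ↓-formula-sound {v} {w} v≤w = val-antitone n v≤w , λ u u≤v u∈ →
      K.trans u≤v v≤w , λ u≈w →
        [ (λ u⊈w → u⊈w (val-antitone n (K.reflexive (K.Eq.sym u≈w))))
        , (λ u⊉ → u⊉ λ x<w → K.trans (proj₁ x<w) (K.reflexive (K.Eq.sym u≈w))) ] u∈

    -- Induction on `v`. If `v` is not strictly below `w`, the implication taken at `v` itself
    -- refutes both disjuncts of its premise, which gives `val≡` and `⇒below`; the induction
    -- hypothesis puts everything strictly below `v` under `w`, and `≈-extensional` applies once
    -- `w < v` is excluded.
    ↓-formula-complete : ∀ {w} v → mem (↓-formula w) v → v K.≤ w
    ↓-formula-complete {w} = All.wfRec <-wellFounded 0ℓ _ step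
      where
      step : ∀ v → (∀ {u} → u < v → mem (↓-formula w) u → u K.≤ w) →
             mem (↓-formula w) v → v K.≤ w
      step v rec v∈@(w⊆v , outside) with em {v < w}
      ... | yes v<w = proj₁ v<w
      ... | no  v≮w = K.reflexive (≈-extensional val≡ below⇒ ⇒below)
        where
        val≡ : val n v ≡ val n w
        val≡ = ⊆-antisym
          (em⇒dne em λ v⊈w → v≮w (outside v K.refl (inj₁ v⊈w))) w⊆v

        ⇒below : ∀ {u} → u < w → u < v
        ⇒below u<w =
          em⇒dne em (λ v⊉ → v≮w (outside v K.refl (inj₂ v⊉))) u<w ,
          λ u≈v → v≮w (decreasing (↓⁻ (K n) w) (K.reflexive (K.Eq.sym u≈v)) u<w)

        below⇒≤ : ∀ {u} → u < v → u K.≤ w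
        below⇒≤ u<v = rec u<v (decreasing (↓-formula w) (proj₁ u<v) v∈)

        -- If `w < v`, the strict down-set of `v` would be exactly `↓ w` although the valuations
        -- agree; `val-≢` forbids this.
        w≮v : ¬ w < v
        w≮v w<v = val-≢ {v} {w} below⇒≤
          (λ u≤w → decreasing (↓⁻ (K n) v) u≤w w<v) val≡

        below⇒ : ∀ {u} → u < v → u < w
        below⇒ u<v = below⇒≤ u<v ,
          λ u≈w → w≮v (decreasing (↓⁻ (K n) v) (K.reflexive (K.Eq.sym u≈w)) u<v)

    -- For `v` above `w`, the implication evaluated at `w` would put `w` strictly below itself.
    ↓⇨↓⁻≐∁↑ : ∀ w → mem (↓ (K n) w ℱ̂.⇨ ↓⁻ (K n) w) ≐ mem (∁↑ (K n) w)
    ↓⇨↓⁻≐∁↑ w =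
      (λ f w≤v → <-irrefl K.Eq.refl (f w w≤v K.refl)) ,
      λ w≰v u u≤v u≤w → u≤w , λ u≈w → w≰v (K.trans (K.reflexive (K.Eq.sym u≈w)) u≤v)

    ↓-formula≐↓ : ∀ w → ↓-formula w ℱ̂.≈ ↓ (K n) w
    ↓-formula≐↓ w = (λ {v} → ↓-formula-complete {w} v) , λ {v} → ↓-formula-sound {v} {w}

    -- The two claims need one induction: `↓ w` uses `∁↑ u` for `u < w` through `⟨⊉↓⁻ w ⟩`, and
    -- `∁↑ w` uses `↓ w`.
    ↓-∁↑-generated : ∀ w → Gen (↓ (K n) w) × Gen (∁↑ (K n) w)
    ↓-∁↑-generated = All.wfRec <-wellFounded _ _ λ w IH →
      let ↓⁻w = ↓⁻-generated IH
          ↓w  = resp (↓-formula≐↓ w)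
                  (meet (⊆val-generated (val n w))
                    (impl (join (val⊈-generated (val n w)) (⊉↓⁻-generated IH)) ↓⁻w))
      in ↓w , resp (↓⇨↓⁻≐∁↑ w) (impl ↓w ↓⁻w)

    -- The spectra of `ℱ` and `ℱ̂`.

    module _ {c ℓ₁ ℓ₂} (H : HeytingAlgebra c ℓ₁ ℓ₂) (R : Representation (K n) H) where

      open Representation R
      private
        module H = HeytingAlgebra H
        module Primes = PrincipalPrimes (K n) em <-wellFounded H R

      identifiesSpectrum : (h : Fin n → H.Carrier) → (∀ j → ⟦ h j ⟧ ≡ ĝ n j) →
                           IdentifiesSpectrum n H x h
      identifiesSpectrum h ⟦h⟧≡ĝ = record
        { inSpec             = Primes.inSpec
        ; isOrderIsomorphism = Primes.φ-isOrderIsomorphism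
        ; val⇔∉              = λ {w} {𝔦} → val⇔∉ {w} {𝔦}
        -- `Ī₀` unfolds to non-membership in the ideal, so the same proof serves.
        ; val⇔Ī₀             = λ {w} {𝔦} → val⇔∉ {w} {𝔦}
        }
        where
        val⇔∉ : ∀ {w 𝔦} → Poset._≈_ (Spec⁰ H) (Primes.φ w) 𝔦 →
                ∀ j → j ∈ val n w ⇔ (¬ ideal 𝔦 (h j))
        val⇔∉ {w} {𝔦} φw≈𝔦 j =
          subst (λ a → mem a w ⇔ (¬ ideal 𝔦 (h j))) (⟦h⟧≡ĝ j)
            (Primes.∈⇔∉ideal {w} {𝔦} φw≈𝔦 (h j))

    ∁↑-generated : ∀ w → Gen (∁↑ (K n) w)
    ∁↑-generated = proj₂ ∘ ↓-∁↑-generated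

    -- Definability enters here: `↓ w` and `∁↑ w` must be generated to be elements of `ℱ`, whereas
    -- in `ℱ̂` they are available outright.
    ℱ-representation : Representation (K n) (ℱ n)
    ℱ-representation = record
      { ⟦_⟧    = proj₁
      ; mono   = id
      ; cancel = id
      ; ↓ᴴ     = λ w → ↓ (K n) w , proj₁ (↓-∁↑-generated w)
      ; x      = λ w → ∁↑ (K n) w , ∁↑-generated w
      ; ↓ᴴ≐    = λ _ → id , id
      ; x≐     = λ _ → id , id
      }

    ℱ̂-representation : Representation (K n) (ℱ̂ n)
    ℱ̂-representation = record
      { ⟦_⟧    = id
      ; mono   = id
      ; cancel = id
      ; ↓ᴴ     = ↓ (K n)
      ; x      = ∁↑ (K n)
      ; ↓ᴴ≐    = λ _ → id , id
      ; x≐     = λ _ → id , id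
      }

theorem5p7 : ExcludedMiddle 0ℓ → (n : ℕ) → 1 ≤ n →
    (Σ[ ∁↑∈ℱ ∈ (∀ w → Generated (ℱ̂ n) (ĝ n) (∁↑ (K n) w)) ]
    IdentifiesSpectrum n (ℱ n) (λ w → ∁↑ (K n) w , ∁↑∈ℱ w) (g n))
    × IdentifiesSpectrum n (ℱ̂ n) (∁↑ (K n)) (ĝ n)
theorem5p7 em n _ =
  ( ∁↑-generated em n
  , identifiesSpectrum em n (ℱ n) (ℱ-representation em n) (g n) (λ _ → refl))
  , identifiesSpectrum em n (ℱ̂ n) (ℱ̂-representation em n) (ĝ n) (λ _ → refl)
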